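{- Let $h$ be a Boolean function computed by an unweighted majority gate of fan-in $s\geq 1$. Let $f,g_1,\ldots,g_s$ be Boolean functions on $n$ variables such that $\max_{i\in[s]}\mathrm{Corr}(f,g_i)\leq 1/(16s)$ and $\mathrm{Corr}(f,1)\leq 1/(16s)$, where $1$ is the constant function $1$. Then $\mathrm{Corr}(f,h(g_1,\ldots,g_s))\leq 1-1/(8s)$.
   Context: Boolean functions map $\{ -1,1\}^n\to\{ -1,1\}$; $\mathrm{Corr}(f,g)=|\mathbb{E}_x[f(x)g(x)]|$ for uniform $x$. An unweighted majority gate of fan-in $s$ computes $h(x_1,\ldots,x_s)=\mathrm{sgn}(\sum_{i\leq s}w_ix_i-\theta)$ with $\theta\in\mathbb{R}$ and $|w_i|=1$ for all $i$, where $\mathrm{sgn}(0)=-1$.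
   Formalization: The threshold θ of the unweighted majority gate takes values in ℚ rather than ℝ. -}

module Defs where

open import Data.Nat as ℕ using (ℕ; zero; suc; _^_)
open import Data.Nat.Properties using (m^n≢0)
open import Data.Integer as ℤ using (ℤ; +_; _◃_)
open import Data.Rational as ℚ using (ℚ; _/_; ∣_∣)
open import Data.Rational.Properties using (_<?_)
open import Data.Sign as Sign using (Sign)
open import Data.Fin using (Fin; zero; suc)
open import Data.List using (List; []; _∷_; _++_; map; foldr)
open import Relation.Nullary using (yes; no)
open import Relation.Binary.PropositionalEquality using (_≡_)
open import Data.Product using (Σ; ∃)

-- A point of the cube {-1,1}^n : Sign.- plays -1, Sign.+ plays 1.
Point : ℕ → Set
Point n = Fin n → Sign

-- Boolean function {-1,1}^n → {-1,1}
BoolFun : ℕ → Set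
BoolFun n = Point n → Sign

-- value of a sign as an integer (±1)
val : Sign → ℤ
val s = s ◃ 1

-- explicit enumeration of all 2^n points of {-1,1}^n (each exactly once)
cube : (n : ℕ) → List (Point n)
cube zero = (λ ()) ∷ []
cube (suc n) = map (λ x → cons Sign.- x) (cube n) ++ map (λ x → cons Sign.+ x) (cube n)
  where
  cons : Sign → Point n → Point (suc n)
  cons a x zero = a
  cons a x (suc i) = x i

sumℤ : List ℤ → ℤ
sumℤ = foldr ℤ._+_ (+ 0)

-- E_x[f(x)] for x uniform on {-1,1}^n
Expect : (n : ℕ) → BoolFun n → ℚ
Expect n f = (sumℤ (map (λ x → val (f x)) (cube n)) / (2 ^ n)) {{m^n≢0 2 n}}

-- Corr(f,g) = | E_x[f(x) g(x)] |
Corr : {n : ℕ} → BoolFun n → BoolFun n → ℚ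
Corr {n} f g = ∣ Expect n (λ x → f x Sign.* g x) ∣

-- the constant function 1
one : {n : ℕ} → BoolFun n
one _ = Sign.+

-- sgn with the convention sgn(0) = -1
sgn : ℚ → Sign
sgn q with ℚ.0ℚ <? q
... | yes _ = Sign.+
... | no _ = Sign.-

-- h is computed by an unweighted majority gate of fan-in s:
-- h(x) = sgn(Σ_i w_i x_i - θ) with |w_i| = 1 (w_i ∈ {-1,1}) and threshold θ.
IsUnweightedMajority : (s : ℕ) → BoolFun s → Set
IsUnweightedMajority s h =
  Σ (Fin s → Sign) λ w → Σ ℚ λ θ →
    ∀ (x : Point s) →
      h x ≡ sgn (ℚ._-_ ((sumℤ (map (λ i → val (w i Sign.* x i)) (allFin s)) / 1)) θ)
  where open import Data.List using (allFin)

-- composition h(g_1,...,g_s)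
compose : {n s : ℕ} → BoolFun s → (Fin s → BoolFun n) → BoolFun n
compose h g x = h (λ i → g i x)

-- Write S(y) = Σᵢ wᵢ yᵢ for the input of the gate. As S takes integer values in [-s, s],
-- there is an integer c with |c| ≤ 2s + 1 such that h(y) is the sign of the odd integer
-- T = 2S(y) - c; then 1 ≤ h T ≤ 4s + 1 =: M, hence |T - M h| ≤ M - 1 pointwise. Summing
-- against f over the cube gives M |E[f h]| ≤ |E[f T]| + M - 1. Since
-- E[f T] = 2 Σᵢ wᵢ E[f gᵢ] - c E[f], the hypotheses bound |E[f T]| by
-- 1/8 + (2s + 1)/(16s) ≤ M/(16s), and this rearranges to |E[f h]| ≤ 1 - 1/(8s).
-- Expectations are kept as integer sums over the 2ⁿ points of the cube until the very end.

module Submission where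

open import Data.Fin using (Fin)
open import Data.List using (List; []; _∷_; map; length; allFin; _++_)
import Data.List.Properties as List
open import Data.Nat as ℕ using (ℕ; zero; suc; NonZero; _^_)
import Data.Nat.Properties as ℕ
import Data.Nat.Tactic.RingSolver as ℕ-Solver
open import Data.Integer as ℤ using (ℤ; +_; -[1+_]; 0ℤ; 1ℤ; -1ℤ; ∣_∣)
import Data.Integer.Properties as ℤ
open import Data.Integer.Tactic.RingSolver using (solve-∀)
open import Data.Rational as ℚ using (ℚ; _/_; 1ℚ; toℚᵘ)
open import Data.Rational.Properties
  using (_<?_; toℚᵘ-fromℚᵘ; toℚᵘ-homo-∣-∣; toℚᵘ-homo-+; toℚᵘ-homo‿-; toℚᵘ-mono-≤; toℚᵘ-cancel-≤)
import Data.Rational.Properties as ℚ using (+-monoˡ-≤; <-≤-trans)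
open import Data.Rational.Unnormalised as ℚᵘ using (mkℚᵘ; _≃_; *≤*)
import Data.Rational.Unnormalised.Properties as ℚᵘ
open import Data.Sign as Sign using (Sign)
import Data.Sign.Properties as Sign
open import Data.Product using (∃-syntax; _×_; _,_; proj₁; proj₂)
open import Function using (_⇔_; mk⇔; Equivalence; case_of_)
open import Relation.Binary.PropositionalEquality
open import Relation.Nullary using (yes; no; contradiction)
open import Relation.Unary using (Pred; Decidable)
open import Level using (0ℓ)

open import Defs

private variable
  A B : Set

toℚᵘ-/ : ∀ i n .{{_ : NonZero n}} → toℚᵘ (i / n) ≃ i ℚᵘ./ n
toℚᵘ-/ i (suc n) = toℚᵘ-fromℚᵘ (mkℚᵘ i n)

toℚᵘ-∣/∣ : ∀ i n .{{_ : NonZero n}} → toℚᵘ (ℚ.∣ i / n ∣) ≃ + ∣ i ∣ ℚᵘ./ n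
toℚᵘ-∣/∣ i n@(suc _) = ℚᵘ.≃-trans (toℚᵘ-homo-∣-∣ (i / n)) (ℚᵘ.∣-∣-cong (toℚᵘ-/ i n))

toℚᵘ-1-1/ : ∀ q .{{_ : NonZero q}} → toℚᵘ (1ℚ ℚ.- + 1 / q) ≃ ℚᵘ.1ℚᵘ ℚᵘ.- + 1 ℚᵘ./ q
toℚᵘ-1-1/ q = ℚᵘ.≃-trans (toℚᵘ-homo-+ 1ℚ (ℚ.- (+ 1 / q)))
  (ℚᵘ.+-cong (ℚᵘ.≃-refl {ℚᵘ.1ℚᵘ}) (ℚᵘ.≃-trans (toℚᵘ-homo‿- (+ 1 / q)) (ℚᵘ.-‿cong (toℚᵘ-/ (+ 1) q))))

/-monoˡ-≤ : ∀ {i j} n .{{_ : NonZero n}} → i ℤ.≤ j → i / n ℚ.≤ j / n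
/-monoˡ-≤ {i} {j} n@(suc _) i≤j = toℚᵘ-cancel-≤
  (ℚᵘ.≤-respʳ-≃ (ℚᵘ.≃-sym (toℚᵘ-/ j n)) (ℚᵘ.≤-respˡ-≃ (ℚᵘ.≃-sym (toℚᵘ-/ i n))
    (*≤* (ℤ.*-monoʳ-≤-nonNeg (+ n) i≤j))))

∣/∣≤1/⇒ : ∀ i n q .{{_ : NonZero n}} .{{_ : NonZero q}} →
          ℚ.∣ i / n ∣ ℚ.≤ + 1 / q → q ℕ.* ∣ i ∣ ℕ.≤ n
∣/∣≤1/⇒ i n@(suc _) q@(suc _) ∣i/n∣≤1/q
  with ℚᵘ.≤-respʳ-≃ (toℚᵘ-/ (+ 1) q) (ℚᵘ.≤-respˡ-≃ (toℚᵘ-∣/∣ i n) (toℚᵘ-mono-≤ ∣i/n∣≤1/q))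
... | *≤* le = ℤ.drop‿+≤+ (subst₂ ℤ._≤_ (trans (sym (ℤ.pos-* ∣ i ∣ q)) (cong +_ (ℕ.*-comm ∣ i ∣ q)))
                                        (ℤ.*-identityˡ (+ n)) le)

∣/∣≤1-1/⇐ : ∀ i n q .{{_ : NonZero n}} .{{_ : NonZero q}} →
            ∣ i ∣ ℕ.* q ℕ.+ n ℕ.≤ q ℕ.* n → ℚ.∣ i / n ∣ ℚ.≤ 1ℚ ℚ.- + 1 / q
∣/∣≤1-1/⇐ i n@(suc _) q@(suc _) le = toℚᵘ-cancel-≤
  (ℚᵘ.≤-respʳ-≃ (ℚᵘ.≃-sym (toℚᵘ-1-1/ q)) (ℚᵘ.≤-respˡ-≃ (ℚᵘ.≃-sym (toℚᵘ-∣/∣ i n))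
    (*≤* (numerators {∣ i ∣} {q} {n} le))))
  where
  open import Data.Integer using (_+_; _*_; _-_; -_; _≤_)
  -- the unfolded unnormalised comparison of ∣i∣/n with 1 - 1/q
  numerators : ∀ {a q n} → a ℕ.* q ℕ.+ n ℕ.≤ q ℕ.* n → + a * + (1 ℕ.* q) ≤ (+ 1 * + q + -1ℤ * + 1) * + n
  numerators {a} {q} {n} le = begin
    + a * + (1 ℕ.* q)                 ≡⟨ cong (λ m → + a * + m) (ℕ.*-identityˡ q) ⟩
    + a * + q                         ≡⟨ ℤ.pos-* a q ⟨
    + (a ℕ.* q)                       ≡⟨ add-sub (+ (a ℕ.* q)) (+ n) ⟩
    + (a ℕ.* q) + + n - + n           ≡⟨ cong (_- + n) (ℤ.pos-+ (a ℕ.* q) n) ⟨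
    + (a ℕ.* q ℕ.+ n) - + n           ≤⟨ ℤ.+-monoˡ-≤ (- + n) (ℤ.+≤+ le) ⟩
    + (q ℕ.* n) - + n                 ≡⟨ cong (_- + n) (ℤ.pos-* q n) ⟩
    + q * + n - + n                   ≡⟨ sub-one (+ q) (+ n) ⟩
    (+ 1 * + q + -1ℤ * + 1) * + n     ∎
    where
    open ℤ.≤-Reasoning
    add-sub : ∀ x y → x ≡ x + y - y
    add-sub = solve-∀
    sub-one : ∀ x y → x * y - y ≡ (+ 1 * x + -1ℤ * + 1) * y
    sub-one = solve-∀

module _ where
  open import Data.Integer using (_+_; _*_; _-_; -_; _≤_; _<_)

  -- Written with sumℤ ∘ map, as in Defs, so that Expect and the gate input unfold to ∑.
  ∑ : List A → (A → ℤ) → ℤ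
  ∑ xs f = sumℤ (map f xs)

  infix 5 ∑
  syntax ∑ xs (λ x → e) = ∑[ x ∈ xs ] e

  ∑-+ : ∀ (xs : List A) (f g : A → ℤ) → ∑[ x ∈ xs ] (f x + g x) ≡ ∑ xs f + ∑ xs g
  ∑-+ [] f g = refl
  ∑-+ (x ∷ xs) f g = trans (cong (_+_ (f x + g x)) (∑-+ xs f g)) (interchange (f x) (g x) _ _)
    where
    interchange : ∀ a b c d → a + b + (c + d) ≡ a + c + (b + d)
    interchange = solve-∀

  ∑-- : ∀ (xs : List A) (f g : A → ℤ) → ∑[ x ∈ xs ] (f x - g x) ≡ ∑ xs f - ∑ xs g
  ∑-- [] f g = refl
  ∑-- (x ∷ xs) f g = trans (cong (_+_ (f x - g x)) (∑-- xs f g)) (interchange (f x) (g x) _ _)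
    where
    interchange : ∀ a b c d → a - b + (c - d) ≡ a + c - (b + d)
    interchange = solve-∀

  ∑-*ˡ : ∀ c (xs : List A) (f : A → ℤ) → ∑[ x ∈ xs ] (c * f x) ≡ c * ∑ xs f
  ∑-*ˡ c [] f = sym (ℤ.*-zeroʳ c)
  ∑-*ˡ c (x ∷ xs) f = trans (cong (_+_ (c * f x)) (∑-*ˡ c xs f)) (sym (ℤ.*-distribˡ-+ c (f x) _))

  ∑-zero : ∀ (xs : List A) → ∑[ x ∈ xs ] 0ℤ ≡ 0ℤ
  ∑-zero [] = refl
  ∑-zero (x ∷ xs) = trans (ℤ.+-identityˡ _) (∑-zero xs)

  ∑-swap : ∀ (xs : List A) (ys : List B) (u : A → B → ℤ) →
           ∑[ x ∈ xs ] ∑[ y ∈ ys ] u x y ≡ ∑[ y ∈ ys ] ∑[ x ∈ xs ] u x y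
  ∑-swap [] ys u = sym (∑-zero ys)
  ∑-swap (x ∷ xs) ys u =
    trans (cong (_+_ (∑ ys (u x))) (∑-swap xs ys u)) (sym (∑-+ ys (u x) (λ y → ∑[ x′ ∈ xs ] u x′ y)))

  ∑-cong : ∀ (xs : List A) {f g : A → ℤ} → (∀ x → f x ≡ g x) → ∑ xs f ≡ ∑ xs g
  ∑-cong [] f≗g = refl
  ∑-cong (x ∷ xs) f≗g = cong₂ _+_ (f≗g x) (∑-cong xs f≗g)

  ∣∑∣≤ : ∀ k b (xs : List A) (f : A → ℤ) → (∀ x → k ℕ.* ∣ f x ∣ ℕ.≤ b) →
         k ℕ.* ∣ ∑ xs f ∣ ℕ.≤ length xs ℕ.* b
  ∣∑∣≤ k b [] f bound = ℕ.≤-reflexive (ℕ.*-zeroʳ k)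
  ∣∑∣≤ k b (x ∷ xs) f bound = begin
    k ℕ.* ∣ f x + ∑ xs f ∣                  ≤⟨ ℕ.*-monoʳ-≤ k (ℤ.∣i+j∣≤∣i∣+∣j∣ (f x) _) ⟩
    k ℕ.* (∣ f x ∣ ℕ.+ ∣ ∑ xs f ∣)           ≡⟨ ℕ.*-distribˡ-+ k ∣ f x ∣ _ ⟩
    k ℕ.* ∣ f x ∣ ℕ.+ k ℕ.* ∣ ∑ xs f ∣       ≤⟨ ℕ.+-mono-≤ (bound x) (∣∑∣≤ k b xs f bound) ⟩
    b ℕ.+ length xs ℕ.* b                   ∎
    where
    open ℕ.≤-Reasoning

  ∣∑∣≤-length : ∀ b (xs : List A) (f : A → ℤ) → (∀ x → ∣ f x ∣ ℕ.≤ b) → ∣ ∑ xs f ∣ ℕ.≤ length xs ℕ.* b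
  ∣∑∣≤-length b xs f bound =
    subst (ℕ._≤ _) (ℕ.*-identityˡ _)
      (∣∑∣≤ 1 b xs f (λ x → subst (ℕ._≤ b) (sym (ℕ.*-identityˡ _)) (bound x)))

  val-* : ∀ a b → val (a Sign.* b) ≡ val a * val b
  val-* a b = ℤ.◃-distrib-* a b 1 1

  ∣val*∣ : ∀ a i → ∣ val a * i ∣ ≡ ∣ i ∣
  ∣val*∣ a i = trans (ℤ.∣i*j∣≡∣i∣*∣j∣ (val a) i)
                     (trans (cong (ℕ._* ∣ i ∣) (ℤ.abs-◃ a 1)) (ℕ.*-identityˡ ∣ i ∣))

  i≤+∣i∣ : ∀ i → i ≤ + ∣ i ∣
  i≤+∣i∣ (+ n) = ℤ.≤-refl
  i≤+∣i∣ -[1+ n ] = ℤ.-≤+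

  ∣i∣≤n⇒i≤n : ∀ {i n} → ∣ i ∣ ℕ.≤ n → i ≤ + n
  ∣i∣≤n⇒i≤n {i} ∣i∣≤n = ℤ.≤-trans (i≤+∣i∣ i) (ℤ.+≤+ ∣i∣≤n)

  ∣i∣≤n⇒-n≤i : ∀ {i n} → ∣ i ∣ ℕ.≤ n → - + n ≤ i
  ∣i∣≤n⇒-n≤i {i} ∣i∣≤n =
    subst (- + _ ≤_) (ℤ.neg-involutive i) (ℤ.neg-mono-≤ (∣i∣≤n⇒i≤n (subst (ℕ._≤ _) (sym (ℤ.∣-i∣≡∣i∣ i)) ∣i∣≤n)))

  -n≤i≤n⇒∣i∣≤n : ∀ {i n} → - + n ≤ i → i ≤ + n → ∣ i ∣ ℕ.≤ n
  -n≤i≤n⇒∣i∣≤n {+ _} _ i≤n = ℤ.drop‿+≤+ i≤n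
  -n≤i≤n⇒∣i∣≤n { -[1+ _ ]} {n} -n≤i _ = ℤ.drop‿+≤+ (subst (_ ≤_) (ℤ.neg-involutive (+ n)) (ℤ.neg-mono-≤ -n≤i))

  1≤i≤1+m⇒∣i-[1+m]∣≤m : ∀ {i m} → 1ℤ ≤ i → i ≤ + suc m → ∣ i - + suc m ∣ ℕ.≤ m
  1≤i≤1+m⇒∣i-[1+m]∣≤m {i} {m} 1≤i i≤n = ℤ.drop‿+≤+ (begin
    + ∣ i - + suc m ∣  ≡⟨ ℤ.∣-∣-≤ i≤n ⟩
    + suc m - i        ≤⟨ ℤ.+-monoʳ-≤ (+ suc m) (ℤ.neg-mono-≤ 1≤i) ⟩
    + suc m - 1ℤ       ≡⟨⟩
    + m                ∎)
    where open ℤ.≤-Reasoning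

  1≤b*t⇒∣t-b*[1+m]∣≤m : ∀ b {t m} → 1ℤ ≤ val b * t → ∣ t ∣ ℕ.≤ suc m → ∣ t - val b * + suc m ∣ ℕ.≤ m
  1≤b*t⇒∣t-b*[1+m]∣≤m Sign.+ {t} {m} 1≤t ∣t∣≤1+m =
    subst (λ v → ∣ t - v ∣ ℕ.≤ m) (sym (ℤ.*-identityˡ (+ suc m)))
      (1≤i≤1+m⇒∣i-[1+m]∣≤m (subst (1ℤ ≤_) (ℤ.*-identityˡ t) 1≤t) (∣i∣≤n⇒i≤n ∣t∣≤1+m))
  1≤b*t⇒∣t-b*[1+m]∣≤m Sign.- {t} {m} 1≤-t ∣t∣≤1+m =
    subst (ℕ._≤ m) (trans (sym (ℤ.∣-i∣≡∣i∣ (- t - + suc m))) (cong ∣_∣ (flip t (+ suc m))))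
      (1≤i≤1+m⇒∣i-[1+m]∣≤m (subst (1ℤ ≤_) (ℤ.-1*i≡-i t) 1≤-t)
        (∣i∣≤n⇒i≤n (subst (ℕ._≤ suc m) (sym (ℤ.∣-i∣≡∣i∣ t)) ∣t∣≤1+m)))
    where
    flip : ∀ t n → - (- t - n) ≡ t - -1ℤ * n
    flip = solve-∀

  threshold : ∀ {P : Pred ℤ 0ℓ} → Decidable P → (∀ {i j} → i ≤ j → P i → P j) → ∀ lo m →
              ∃[ k ] lo ≤ k × k ≤ lo + + m × (∀ {z} → lo ≤ z → z < lo + + m → P z ⇔ k ≤ z)
  threshold P? mono lo zero =
    lo , ℤ.≤-refl , ℤ.≤-reflexive (sym (ℤ.+-identityʳ lo)) ,
    λ lo≤z z<lo → contradiction (ℤ.≤-<-trans lo≤z (subst (_ <_) (ℤ.+-identityʳ lo) z<lo)) (ℤ.<-irrefl refl)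
  threshold {P} P? mono lo (suc m) with P? lo
  ... | yes Plo = lo , ℤ.≤-refl , ℤ.i≤i+j lo (+ suc m) , λ lo≤z _ → mk⇔ (λ _ → lo≤z) (λ _ → mono lo≤z Plo)
  ... | no ¬Plo with threshold P? mono (ℤ.suc lo) m
  ...   | k , 1+lo≤k , k≤ , P⇔ = k , ℤ.≤-trans (ℤ.i≤suc[i] lo) 1+lo≤k , subst (k ≤_) shift k≤ , P⇔′
    where
    shift : ℤ.suc lo + + m ≡ lo + + suc m
    shift = reassociate lo (+ m)
      where
      reassociate : ∀ i j → (1ℤ + i) + j ≡ i + (1ℤ + j)
      reassociate = solve-∀
    P⇔′ : ∀ {z} → lo ≤ z → z < lo + + suc m → P z ⇔ k ≤ z
    P⇔′ {z} lo≤z z<lo+1+m with lo ℤ.≟ z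
    ... | yes refl = mk⇔ (λ Plo → contradiction Plo ¬Plo)
                         (λ k≤lo → contradiction (ℤ.suc[i]≤j⇒i<j (ℤ.≤-trans 1+lo≤k k≤lo)) (ℤ.<-irrefl refl))
    ... | no lo≢z = P⇔ (ℤ.i<j⇒suc[i]≤j (ℤ.≤∧≢⇒< lo≤z lo≢z)) (subst (z <_) (sym shift) z<lo+1+m)

  length-allFin : ∀ s → length (allFin s) ≡ s
  length-allFin s = List.length-tabulate (λ i → i)

  length-cube : ∀ n → length (cube n) ≡ 2 ^ n
  length-cube zero = refl
  length-cube (suc n) = begin
    length (map _ (cube n) ++ map _ (cube n))       ≡⟨ List.length-++ (map _ (cube n)) ⟩
    length (map _ (cube n)) ℕ.+ length (map _ (cube n))
      ≡⟨ cong₂ ℕ._+_ (List.length-map _ (cube n)) (List.length-map _ (cube n)) ⟩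
    length (cube n) ℕ.+ length (cube n)             ≡⟨ cong (λ l → l ℕ.+ l) (length-cube n) ⟩
    2 ^ n ℕ.+ 2 ^ n                                 ≡⟨ cong (2 ^ n ℕ.+_) (ℕ.+-identityʳ (2 ^ n)) ⟨
    2 ^ suc n                                       ∎
    where open ≡-Reasoning

  gateSum : ∀ {s} → (Fin s → Sign) → Point s → ℤ
  gateSum {s} w y = ∑[ i ∈ allFin s ] val (w i Sign.* y i)

  gate : ∀ {s} → (Fin s → Sign) → ℚ → BoolFun s
  gate w θ y = sgn (gateSum w y ℚ./ 1 ℚ.- θ)

  ∣gateSum∣≤ : ∀ {s} (w : Fin s → Sign) y → ∣ gateSum w y ∣ ℕ.≤ s
  ∣gateSum∣≤ {s} w y = subst (∣ gateSum w y ∣ ℕ.≤_) (trans (cong (ℕ._* 1) (length-allFin s)) (ℕ.*-identityʳ s))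
    (∣∑∣≤-length 1 (allFin s) (λ i → val (w i Sign.* y i)) (λ i → ℕ.≤-reflexive (ℤ.abs-◃ (w i Sign.* y i) 1)))

  sgn≡+⇔0< : ∀ q → sgn q ≡ Sign.+ ⇔ ℚ.0ℚ ℚ.< q
  sgn≡+⇔0< q with ℚ.0ℚ <? q
  ... | yes 0<q = mk⇔ (λ _ → 0<q) (λ _ → refl)
  ... | no 0≮q = mk⇔ (λ ()) (λ 0<q → contradiction 0<q 0≮q)

  +[1+2n] : ∀ n → + suc (2 ℕ.* n) ≡ 1ℤ + + 2 * + n
  +[1+2n] n = cong (_+_ 1ℤ) (ℤ.pos-* 2 n)

  gate-threshold : ∀ {s} (w : Fin s → Sign) θ →
    ∃[ k ] - + s ≤ k × k ≤ + suc s × ∀ y → gate w θ y ≡ Sign.+ ⇔ k ≤ gateSum w y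
  gate-threshold {s} w θ =
    let k , -s≤k , k≤top , P⇔ = threshold (λ z → sgn (z ℚ./ 1 ℚ.- θ) Sign.≟ Sign.+) mono (- + s) (suc (2 ℕ.* s))
    in k , -s≤k , subst (k ≤_) top≡ k≤top ,
       λ y → P⇔ (∣i∣≤n⇒-n≤i (∣gateSum∣≤ w y))
                (subst (gateSum w y <_) (sym top≡) (ℤ.≤-<-trans (∣i∣≤n⇒i≤n (∣gateSum∣≤ w y)) (ℤ.+<+ (ℕ.n<1+n s))))
    where
    mono : ∀ {i j} → i ≤ j → sgn (i ℚ./ 1 ℚ.- θ) ≡ Sign.+ → sgn (j ℚ./ 1 ℚ.- θ) ≡ Sign.+
    mono i≤j sgn≡+ = Equivalence.from (sgn≡+⇔0< _)
      (ℚ.<-≤-trans (Equivalence.to (sgn≡+⇔0< _) sgn≡+) (ℚ.+-monoˡ-≤ (ℚ.- θ) (/-monoˡ-≤ 1 i≤j)))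
    top≡ : - + s + + suc (2 ℕ.* s) ≡ + suc s
    top≡ = trans (cong (_+_ (- + s)) (+[1+2n] s)) (shift (+ s))
      where
      shift : ∀ x → - x + (1ℤ + + 2 * x) ≡ 1ℤ + x
      shift = solve-∀

  threshold-margin : ∀ {b k z} → (b ≡ Sign.+ ⇔ k ≤ z) → 1ℤ ≤ val b * (+ 2 * z - (+ 2 * k - 1ℤ))
  threshold-margin {Sign.+} {k} {z} b⇔k≤z = begin
    1ℤ                                ≤⟨ ℤ.+-monoʳ-≤ 1ℤ (ℤ.*-monoˡ-≤-nonNeg (+ 2) (ℤ.i≤j⇒0≤j-i k≤z)) ⟩
    1ℤ + + 2 * (z - k)                ≡⟨ odd z k ⟩
    1ℤ * (+ 2 * z - (+ 2 * k - 1ℤ))   ∎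
    where
    open ℤ.≤-Reasoning
    k≤z : k ≤ z
    k≤z = Equivalence.to b⇔k≤z refl
    odd : ∀ z k → 1ℤ + + 2 * (z - k) ≡ 1ℤ * (+ 2 * z - (+ 2 * k - 1ℤ))
    odd = solve-∀
  threshold-margin {Sign.-} {k} {z} b⇔k≤z = begin
    1ℤ                                ≤⟨ ℤ.+-monoʳ-≤ 1ℤ (ℤ.*-monoˡ-≤-nonNeg (+ 2) (ℤ.i≤j⇒0≤j-i 1+z≤k)) ⟩
    1ℤ + + 2 * (k - (1ℤ + z))         ≡⟨ odd z k ⟩
    -1ℤ * (+ 2 * z - (+ 2 * k - 1ℤ))  ∎
    where
    open ℤ.≤-Reasoning
    1+z≤k : 1ℤ + z ≤ k
    1+z≤k = ℤ.i<j⇒suc[i]≤j (ℤ.≰⇒> (λ k≤z → case Equivalence.from b⇔k≤z k≤z of λ ()))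
    odd : ∀ z k → 1ℤ + + 2 * (k - (1ℤ + z)) ≡ -1ℤ * (+ 2 * z - (+ 2 * k - 1ℤ))
    odd = solve-∀

  gateForm : ∀ {s} → (Fin s → Sign) → ℤ → Point s → ℤ
  gateForm w c y = + 2 * gateSum w y - c

  gate-margin : ∀ {s} (w : Fin s → Sign) θ → ∃[ c ] ∣ c ∣ ℕ.≤ suc (2 ℕ.* s) ×
    ∀ y → 1ℤ ≤ val (gate w θ y) * gateForm w c y × ∣ gateForm w c y ∣ ℕ.≤ suc (4 ℕ.* s)
  gate-margin {s} w θ =
    let k , -s≤k , k≤1+s , gate⇔ = gate-threshold w θ
        ∣c∣≤ = -n≤i≤n⇒∣i∣≤n (lower k -s≤k) (upper k k≤1+s)
    in + 2 * k - 1ℤ , ∣c∣≤ , λ y → threshold-margin (gate⇔ y) , ∣gateForm∣≤ y ∣c∣≤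
    where
    open ℤ.≤-Reasoning
    lower : ∀ k → - + s ≤ k → - + suc (2 ℕ.* s) ≤ + 2 * k - 1ℤ
    lower k -s≤k = begin
      - + suc (2 ℕ.* s)      ≡⟨ cong -_ (+[1+2n] s) ⟩
      - (1ℤ + + 2 * + s)     ≡⟨ negate (+ s) ⟩
      + 2 * - + s - 1ℤ       ≤⟨ ℤ.+-monoˡ-≤ (- 1ℤ) (ℤ.*-monoˡ-≤-nonNeg (+ 2) -s≤k) ⟩
      + 2 * k - 1ℤ           ∎
      where
      negate : ∀ x → - (1ℤ + + 2 * x) ≡ + 2 * - x - 1ℤ
      negate = solve-∀
    upper : ∀ k → k ≤ + suc s → + 2 * k - 1ℤ ≤ + suc (2 ℕ.* s)
    upper k k≤1+s = begin
      + 2 * k - 1ℤ              ≤⟨ ℤ.+-monoˡ-≤ (- 1ℤ) (ℤ.*-monoˡ-≤-nonNeg (+ 2) k≤1+s) ⟩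
      + 2 * (1ℤ + + s) - 1ℤ     ≡⟨ double (+ s) ⟩
      1ℤ + + 2 * + s            ≡⟨ +[1+2n] s ⟨
      + suc (2 ℕ.* s)           ∎
      where
      double : ∀ x → + 2 * (1ℤ + x) - 1ℤ ≡ 1ℤ + + 2 * x
      double = solve-∀
    ∣gateForm∣≤ : ∀ {c} y → ∣ c ∣ ℕ.≤ suc (2 ℕ.* s) → ∣ gateForm w c y ∣ ℕ.≤ suc (4 ℕ.* s)
    ∣gateForm∣≤ {c} y ∣c∣≤ = ℕ.≤-trans (ℤ.∣i-j∣≤∣i∣+∣j∣ (+ 2 * gateSum w y) c)
      (subst (ℕ._≤ suc (4 ℕ.* s)) (cong (ℕ._+ ∣ c ∣) (sym (ℤ.∣i*j∣≡∣i∣*∣j∣ (+ 2) (gateSum w y))))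
        (ℕ.≤-trans (ℕ.+-mono-≤ (ℕ.*-monoʳ-≤ 2 (∣gateSum∣≤ w y)) ∣c∣≤) (ℕ.≤-reflexive (collect s))))
      where
      collect : ∀ s → 2 ℕ.* s ℕ.+ suc (2 ℕ.* s) ≡ suc (4 ℕ.* s)
      collect = ℕ-Solver.solve-∀

  margin-correlation : ∀ m (xs : List A) (F b : A → Sign) (t : A → ℤ) →
    (∀ x → 1ℤ ≤ val (b x) * t x) → (∀ x → ∣ t x ∣ ℕ.≤ suc m) →
    suc m ℕ.* ∣ (∑[ x ∈ xs ] val (F x Sign.* b x)) ∣ ℕ.≤ ∣ (∑[ x ∈ xs ] val (F x) * t x) ∣ ℕ.+ length xs ℕ.* m
  margin-correlation m xs F b t margin ∣t∣≤ = begin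
    suc m ℕ.* ∣ C ∣               ≡⟨ ℤ.∣i*j∣≡∣i∣*∣j∣ M C ⟨
    ∣ M * C ∣                     ≡⟨ cong ∣_∣ (x-[x-y] X (M * C)) ⟩
    ∣ X - (X - M * C) ∣           ≤⟨ ℤ.∣i-j∣≤∣i∣+∣j∣ X (X - M * C) ⟩
    ∣ X ∣ ℕ.+ ∣ X - M * C ∣       ≤⟨ ℕ.+-monoʳ-≤ ∣ X ∣ deviation ⟩
    ∣ X ∣ ℕ.+ length xs ℕ.* m     ∎
    where
    open ℕ.≤-Reasoning
    M C X : ℤ
    M = + suc m
    C = ∑[ x ∈ xs ] val (F x Sign.* b x)
    X = ∑[ x ∈ xs ] val (F x) * t x
    x-[x-y] : ∀ x y → y ≡ x - (x - y)
    x-[x-y] = solve-∀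
    factor : ∀ f b t n → f * t - n * (f * b) ≡ f * (t - b * n)
    factor = solve-∀
    pointwise : ∀ x → ∣ val (F x) * t x - M * val (F x Sign.* b x) ∣ ℕ.≤ m
    pointwise x = subst (ℕ._≤ m)
      (sym (trans (cong ∣_∣ (trans (cong (λ v → val (F x) * t x - M * v) (val-* (F x) (b x)))
                                   (factor (val (F x)) (val (b x)) (t x) M)))
                  (∣val*∣ (F x) _)))
      (1≤b*t⇒∣t-b*[1+m]∣≤m (b x) (margin x) (∣t∣≤ x))
    deviation : ∣ X - M * C ∣ ℕ.≤ length xs ℕ.* m
    deviation = subst (λ v → ∣ v ∣ ℕ.≤ length xs ℕ.* m)
      (trans (∑-- xs _ _) (cong (_-_ X) (∑-*ˡ M xs _)))
      (∣∑∣≤-length m xs _ pointwise)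

  ∑-val*gateSum : ∀ {s} (xs : List A) (F : A → Sign) (w : Fin s → Sign) (G : Fin s → A → Sign) →
    ∑[ x ∈ xs ] val (F x) * gateSum w (λ i → G i x) ≡
    ∑[ i ∈ allFin s ] val (w i) * (∑[ x ∈ xs ] val (F x Sign.* G i x))
  ∑-val*gateSum {s = s} xs F w G = begin
    ∑[ x ∈ xs ] val (F x) * (∑[ i ∈ allFin s ] val (w i Sign.* G i x))
      ≡⟨ ∑-cong xs (λ x → sym (∑-*ˡ (val (F x)) (allFin s) _)) ⟩
    ∑[ x ∈ xs ] ∑[ i ∈ allFin s ] val (F x) * val (w i Sign.* G i x)
      ≡⟨ ∑-cong xs (λ x → ∑-cong (allFin s) (λ i → swap-signs (F x) (w i) (G i x))) ⟩
    ∑[ x ∈ xs ] ∑[ i ∈ allFin s ] val (w i) * val (F x Sign.* G i x)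
      ≡⟨ ∑-swap xs (allFin s) _ ⟩
    ∑[ i ∈ allFin s ] ∑[ x ∈ xs ] val (w i) * val (F x Sign.* G i x)
      ≡⟨ ∑-cong (allFin s) (λ i → ∑-*ˡ (val (w i)) xs _) ⟩
    ∑[ i ∈ allFin s ] val (w i) * (∑[ x ∈ xs ] val (F x Sign.* G i x)) ∎
    where
    open ≡-Reasoning
    swap-signs : ∀ a b c → val a * val (b Sign.* c) ≡ val b * val (a Sign.* c)
    swap-signs a b c = trans (cong (val a *_) (val-* b c))
      (trans (left-comm (val a) (val b) (val c)) (cong (val b *_) (sym (val-* a c))))
      where
      left-comm : ∀ x y z → x * (y * z) ≡ y * (x * z)
      left-comm = solve-∀

  ∣∑-val*gateForm∣≤ : ∀ {s} (xs : List A) (F : A → Sign) (w : Fin s → Sign) c (G : Fin s → A → Sign) →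
    ∣ ∑[ x ∈ xs ] val (F x) * gateForm w c (λ i → G i x) ∣ ℕ.≤
    2 ℕ.* ∣ ∑[ i ∈ allFin s ] val (w i) * (∑[ x ∈ xs ] val (F x Sign.* G i x)) ∣ ℕ.+
    ∣ c ∣ ℕ.* ∣ ∑[ x ∈ xs ] val (F x Sign.* Sign.+) ∣
  ∣∑-val*gateForm∣≤ {A = A} {s = s} xs F w c G =
    subst (λ v → ∣ v ∣ ℕ.≤ 2 ℕ.* ∣ W ∣ ℕ.+ ∣ c ∣ ℕ.* ∣ E ∣) (sym decompose) ∣2W-cE∣≤
    where
    S : A → ℤ
    S x = gateSum w (λ i → G i x)
    W E : ℤ
    W = ∑[ i ∈ allFin s ] val (w i) * (∑[ x ∈ xs ] val (F x Sign.* G i x))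
    E = ∑[ x ∈ xs ] val (F x Sign.* Sign.+)
    expand : ∀ a s c → a * (+ 2 * s - c) ≡ + 2 * (a * s) - c * (a * 1ℤ)
    expand = solve-∀
    decompose : ∑[ x ∈ xs ] val (F x) * gateForm w c (λ i → G i x) ≡ + 2 * W - c * E
    decompose = begin
      ∑[ x ∈ xs ] val (F x) * (+ 2 * S x - c)
        ≡⟨ ∑-cong xs (λ x → trans (expand (val (F x)) (S x) c)
                                  (cong (λ v → + 2 * (val (F x) * S x) - c * v) (sym (val-* (F x) Sign.+)))) ⟩
      ∑[ x ∈ xs ] (+ 2 * (val (F x) * S x) - c * val (F x Sign.* Sign.+))
        ≡⟨ ∑-- xs _ _ ⟩
      (∑[ x ∈ xs ] + 2 * (val (F x) * S x)) - (∑[ x ∈ xs ] c * val (F x Sign.* Sign.+))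
        ≡⟨ cong₂ _-_ (∑-*ˡ (+ 2) xs _) (∑-*ˡ c xs _) ⟩
      + 2 * (∑[ x ∈ xs ] val (F x) * S x) - c * E
        ≡⟨ cong (λ v → + 2 * v - c * E) (∑-val*gateSum xs F w G) ⟩
      + 2 * W - c * E ∎
      where open ≡-Reasoning
    ∣2W-cE∣≤ : ∣ + 2 * W - c * E ∣ ℕ.≤ 2 ℕ.* ∣ W ∣ ℕ.+ ∣ c ∣ ℕ.* ∣ E ∣
    ∣2W-cE∣≤ = subst (∣ + 2 * W - c * E ∣ ℕ.≤_) (cong₂ ℕ._+_ (ℤ.∣i*j∣≡∣i∣*∣j∣ (+ 2) W) (ℤ.∣i*j∣≡∣i∣*∣j∣ c E))
      (ℤ.∣i-j∣≤∣i∣+∣j∣ (+ 2 * W) (c * E))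

  ∣∑-val*∣≤ : ∀ {s} k N (w : Fin s → Sign) (C : Fin s → ℤ) → (∀ i → k ℕ.* ∣ C i ∣ ℕ.≤ N) →
    k ℕ.* ∣ ∑[ i ∈ allFin s ] val (w i) * C i ∣ ℕ.≤ s ℕ.* N
  ∣∑-val*∣≤ {s} k N w C bound = subst (k ℕ.* ∣ ∑[ i ∈ allFin s ] val (w i) * C i ∣ ℕ.≤_) (cong (ℕ._* N) (length-allFin s))
    (∣∑∣≤ k N (allFin s) (λ i → val (w i) * C i) (λ i → subst (λ v → k ℕ.* v ℕ.≤ N) (sym (∣val*∣ (w i) (C i))) (bound i)))

module _ where
  open import Data.Nat using (_+_; _*_; _≤_)

  linear-form-bound : ∀ {s N x y e γ} → x ≤ 2 * y + γ * e →
    16 * s * y ≤ s * N → 16 * s * e ≤ N → γ ≤ suc (2 * s) →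
    16 * s * x ≤ suc (4 * s) * N
  linear-form-bound {s} {N} {x} {y} {e} {γ} x≤ y≤ e≤ γ≤ = begin
    16 * s * x                        ≤⟨ ℕ.*-monoʳ-≤ (16 * s) x≤ ⟩
    16 * s * (2 * y + γ * e)          ≡⟨ regroup s y γ e ⟩
    2 * (16 * s * y) + γ * (16 * s * e) ≤⟨ ℕ.+-mono-≤ (ℕ.*-monoʳ-≤ 2 y≤) (ℕ.*-mono-≤ γ≤ e≤) ⟩
    2 * (s * N) + suc (2 * s) * N     ≡⟨ collect s N ⟩
    suc (4 * s) * N                   ∎
    where
    open ℕ.≤-Reasoning
    regroup : ∀ s y γ e → 16 * s * (2 * y + γ * e) ≡ 2 * (16 * s * y) + γ * (16 * s * e)
    regroup = ℕ-Solver.solve-∀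
    collect : ∀ s N → 2 * (s * N) + suc (2 * s) * N ≡ suc (4 * s) * N
    collect = ℕ-Solver.solve-∀

  majority-bound : ∀ {s N a x} .{{_ : NonZero s}} →
    suc (4 * s) * a ≤ x + N * (4 * s) → 16 * s * x ≤ suc (4 * s) * N →
    a * (8 * s) + N ≤ 8 * s * N
  -- The slack (4t + 1) N = (16s - 3M) N is where s ≥ 1 is needed.
  majority-bound {suc t} {N} {a} {x} a≤ x≤ = ℕ.*-cancelˡ-≤ (2 * M) (begin
    2 * M * (a * (8 * s) + N)                   ≡⟨ expand s a N ⟩
    16 * s * (M * a) + 2 * M * N                ≤⟨ ℕ.+-monoˡ-≤ (2 * M * N) (ℕ.*-monoʳ-≤ (16 * s) a≤) ⟩
    16 * s * (x + N * (4 * s)) + 2 * M * N      ≡⟨ distribute s x N ⟩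
    16 * s * x + (64 * s * s + 2 * M) * N       ≤⟨ ℕ.+-monoˡ-≤ _ x≤ ⟩
    M * N + (64 * s * s + 2 * M) * N            ≤⟨ ℕ.m≤m+n _ ((4 * t + 1) * N) ⟩
    M * N + (64 * s * s + 2 * M) * N + (4 * t + 1) * N ≡⟨ collect t N ⟩
    2 * M * (8 * s * N)                         ∎)
    where
    open ℕ.≤-Reasoning
    s M : ℕ
    s = suc t
    M = suc (4 * s)
    expand : ∀ s a N → 2 * suc (4 * s) * (a * (8 * s) + N) ≡ 16 * s * (suc (4 * s) * a) + 2 * suc (4 * s) * N
    expand = ℕ-Solver.solve-∀
    distribute : ∀ s x N → 16 * s * (x + N * (4 * s)) + 2 * suc (4 * s) * N ≡ 16 * s * x + (64 * s * s + 2 * suc (4 * s)) * N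
    distribute = ℕ-Solver.solve-∀
    collect : ∀ t N → let s = suc t in
      suc (4 * s) * N + (64 * s * s + 2 * suc (4 * s)) * N + (4 * t + 1) * N ≡ 2 * suc (4 * s) * (8 * s * N)
    collect = ℕ-Solver.solve-∀

  corrSum : ∀ {n} → BoolFun n → BoolFun n → ℤ
  corrSum {n} f φ = ∑[ x ∈ cube n ] val (f x Sign.* φ x)

  majority-correlation : ∀ {n s} .{{_ : NonZero s}} (h : BoolFun s) → IsUnweightedMajority s h →
    (f : BoolFun n) (g : Fin s → BoolFun n) →
    (∀ i → 16 * s * ∣ corrSum f (g i) ∣ ≤ 2 ^ n) → 16 * s * ∣ corrSum f one ∣ ≤ 2 ^ n →
    ∣ corrSum f (compose h g) ∣ * (8 * s) + 2 ^ n ≤ 8 * s * 2 ^ n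
  majority-correlation {n} {s} h (w , θ , h≡gate) f g corr-g corr-1 with gate-margin w θ
  ... | c , ∣c∣≤ , margin = majority-bound {s} H-bound (linear-form-bound {s} X-bound W-bound corr-1 ∣c∣≤)
    where
    t : Point n → ℤ
    t x = gateForm w c (λ i → g i x)
    X W : ℤ
    X = ∑[ x ∈ cube n ] val (f x) ℤ.* t x
    W = ∑[ i ∈ allFin s ] val (w i) ℤ.* corrSum f (g i)
    H-bound : suc (4 * s) * ∣ corrSum f (compose h g) ∣ ≤ ∣ X ∣ + 2 ^ n * (4 * s)
    H-bound = subst (λ l → suc (4 * s) * ∣ corrSum f (compose h g) ∣ ≤ ∣ X ∣ + l * (4 * s)) (length-cube n)
      (margin-correlation (4 * s) (cube n) f (compose h g) t
        (λ x → subst (λ b → 1ℤ ℤ.≤ val b ℤ.* t x) (sym (h≡gate (λ i → g i x))) (proj₁ (margin (λ i → g i x))))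
        (λ x → proj₂ (margin (λ i → g i x))))
    X-bound : ∣ X ∣ ≤ 2 * ∣ W ∣ + ∣ c ∣ * ∣ corrSum f one ∣
    X-bound = ∣∑-val*gateForm∣≤ (cube n) f w c g
    W-bound : 16 * s * ∣ W ∣ ≤ s * 2 ^ n
    W-bound = ∣∑-val*∣≤ (16 * s) (2 ^ n) w (λ i → corrSum f (g i)) corr-g

open import Data.Nat using (ℕ; NonZero; _*_)
open import Data.Nat.Properties using (m*n≢0; m^n≢0)
open import Data.Integer using (+_)
open import Data.Rational using (ℚ; _/_; _≤_; _-_; 1ℚ)
open import Data.Fin using (Fin)

proposition9p5 : (n s : ℕ) → .{{_ : NonZero s}} →
    (h : BoolFun s) → IsUnweightedMajority s h →
    (f : BoolFun n) → (g : Fin s → BoolFun n) →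
    (∀ (i : Fin s) → Corr f (g i) ≤ (+ 1 / (16 * s)) {{m*n≢0 16 s}}) →
    Corr f one ≤ (+ 1 / (16 * s)) {{m*n≢0 16 s}} →
    Corr f (compose h g) ≤ 1ℚ - (+ 1 / (8 * s)) {{m*n≢0 8 s}}
proposition9p5 n s h majority f g corr-g corr-1 =
  ∣/∣≤1-1/⇐ (corrSum f (compose h g)) (2 ^ n) (8 * s) {{m^n≢0 2 n}} {{m*n≢0 8 s}}
    (majority-correlation h majority f g
      (λ i → ∣/∣≤1/⇒ (corrSum f (g i)) (2 ^ n) (16 * s) {{m^n≢0 2 n}} {{m*n≢0 16 s}} (corr-g i))
      (∣/∣≤1/⇒ (corrSum f one) (2 ^ n) (16 * s) {{m^n≢0 2 n}} {{m*n≢0 16 s}} corr-1))
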